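{- Let $G$ be a simple graph and let $e=\{u,v\}$ be an edge of $G$. If the vertices $u$ and $v$ are adjacent to support vertices of $G$ (that is, $u$ is adjacent to a support vertex $w$ and $v$ is adjacent to a support vertex $z$), then $e$ is an irrelevant edge of $G$, i.e. $D_t(G,x)=D_t(G\setminus e,x)$.
   Context: A leaf is a vertex of degree one; a support vertex is a vertex adjacent to a leaf. For a simple graph $G=(V,E)$, a set $D\subseteq V$ is a total dominating set if every vertex of $V$ is adjacent to some vertex of $D$. $d_t(G,i)$ is the number of total dominating sets of $G$ of cardinality $i$, and $D_t(G,x)=\sum_i d_t(G,i)x^i$ is the total domination polynomial of $G$. $G\setminus e$ denotes $G$ with the edge $e$ deleted (vertices kept). An edge $e$ of $G$ is called irrelevant if $D_t(G,x)=D_t(G\setminus e,x)$.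
   Formalization: The support vertex w adjacent to u is required to differ from v, and the support vertex z adjacent to v to differ from u; without this the claim fails, e.g. for the middle edge of the path on four vertices. -}

module Defs where

open import Data.Nat using (ℕ; zero; suc; _≟_)
open import Data.Fin using (Fin; toℕ)
import Data.Fin.Properties as Fin
open import Data.Fin.Subset using (Subset; inside; outside; _∈_; ∣_∣)
open import Data.Fin.Subset.Properties using (_∈?_)
open import Data.List using (List; []; _∷_; map; _++_; length; filter)
open import Data.Product using (_×_; _,_; ∃; proj₁)
open import Data.Sum using (_⊎_; inj₁; inj₂)
import Data.Vec as Vec
open Vec using (Vec)
open import Function using (_∘_)
open import Relation.Binary.PropositionalEquality using (_≡_)
open import Relation.Nullary using (¬_; Dec; does; ¬?; _×-dec_; _⊎-dec_)

record SimpleGraph (n : ℕ) : Set₁ where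
  field
    Adj    : Fin n → Fin n → Set
    adj?   : ∀ x y → Dec (Adj x y)
    symm   : ∀ {x y} → Adj x y → Adj y x
    irrefl : ∀ {x} → ¬ Adj x x

open SimpleGraph public

neighbours : ∀ {n} → SimpleGraph n → Fin n → Subset n
neighbours G v = Vec.tabulate (λ w → does (adj? G v w))

degree : ∀ {n} → SimpleGraph n → Fin n → ℕ
degree G v = ∣ neighbours G v ∣

Leaf : ∀ {n} → SimpleGraph n → Fin n → Set
Leaf G v = degree G v ≡ 1

Support : ∀ {n} → SimpleGraph n → Fin n → Set
Support G w = ∃ λ ℓ → Leaf G ℓ × Adj G w ℓ

TotalDominating : ∀ {n} → SimpleGraph n → Subset n → Set
TotalDominating G D = ∀ v → ∃ λ d → d ∈ D × Adj G v d

totalDominating? : ∀ {n} (G : SimpleGraph n) (D : Subset n) → Dec (TotalDominating G D)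
totalDominating? G D = Fin.all? λ v → Fin.any? λ d → (d ∈? D) ×-dec adj? G v d

-- Every subset of Fin n, listed exactly once.
subsets : ∀ n → List (Subset n)
subsets zero    = Vec.[] ∷ []
subsets (suc n) = map (outside Vec.∷_) (subsets n) ++ map (inside Vec.∷_) (subsets n)

dₜ : ∀ {n} → SimpleGraph n → ℕ → ℕ
dₜ {n} G i = length (filter (λ D → totalDominating? G D ×-dec (∣ D ∣ ≟ i)) (subsets n))

-- A polynomial of degree at most n over ℕ, as its vector of coefficients of
-- x⁰, …, xⁿ; equality of such polynomials is equality of these vectors.
Poly≤ : ℕ → Set
Poly≤ n = Vec ℕ (suc n)

-- On n vertices dₜ G i = 0 for i > n, so the sum Σᵢ dₜ(G,i) xⁱ stops at i = n.
Dₜ : ∀ {n} → SimpleGraph n → Poly≤ n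
Dₜ G = Vec.tabulate (λ i → dₜ G (toℕ i))

-- {x , y} = {u , v} as unordered pairs.
SamePair : ∀ {n} → Fin n → Fin n → Fin n → Fin n → Set
SamePair x y u v = (x ≡ u × y ≡ v) ⊎ (x ≡ v × y ≡ u)

samePair? : ∀ {n} (x y u v : Fin n) → Dec (SamePair x y u v)
samePair? x y u v = (x Fin.≟ u ×-dec y Fin.≟ v) ⊎-dec (x Fin.≟ v ×-dec y Fin.≟ u)

samePair-swap : ∀ {n} {x y u v : Fin n} → SamePair y x u v → SamePair x y u v
samePair-swap (inj₁ (p , q)) = inj₂ (q , p)
samePair-swap (inj₂ (p , q)) = inj₁ (q , p)

-- The edge {u , v} is given by a proof of adjacency e; only its endpoints matter.
_∖_ : ∀ {n} (G : SimpleGraph n) {u v : Fin n} → Adj G u v → SimpleGraph n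
_∖_ G {u} {v} e = record
  { Adj    = λ x y → Adj G x y × ¬ SamePair x y u v
  ; adj?   = λ x y → adj? G x y ×-dec ¬? (samePair? x y u v)
  ; symm   = λ (a , ne) → symm G a , ne ∘ samePair-swap
  ; irrefl = irrefl G ∘ proj₁
  }

Irrelevant : ∀ {n} (G : SimpleGraph n) {u v : Fin n} → Adj G u v → Set
Irrelevant G e = Dₜ G ≡ Dₜ (G ∖ e)

{-# OPTIONS --safe #-}
module Submission where

open import Data.Nat using (ℕ; _≟_)
open import Data.Nat.Properties using (<-≤-trans; n≮0; n<1⇒n≡0; ≤-reflexive)
open import Data.Fin using (Fin; toℕ)
import Data.Fin.Properties as Fin
open import Data.Fin.Subset using (Subset; _∈_; ∣_∣)
open import Data.Fin.Subset.Properties using (x∈p⇒∣p-x∣<∣p∣; x∈p∧x≢y⇒x∈p-y)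
open import Data.List using (length)
open import Data.List.Properties using (filter-≐)
open import Data.Product using (_×_; _,_; ∃; map₁)
open import Data.Sum using (inj₁; inj₂)
open import Data.Vec.Properties using (lookup∘tabulate; lookup⇒[]=; tabulate-cong)
open import Function using (_∘_)
open import Relation.Binary.PropositionalEquality using (_≡_; _≢_; refl; trans; cong; subst)
open import Relation.Nullary using (yes; no; _×-dec_)
open import Relation.Nullary.Decidable using (dec-true; decidable-stable)
open import Defs

-- A leaf can only be dominated by its support vertex, so every total dominating set contains all
-- support vertices (`support∈D`). Hence `w` and `z` keep dominating `u` and `v` once these stop
-- dominating each other. So `G` and `G ∖ e` have the same total dominating sets, and the
-- polynomials agree coefficient by coefficient.

-- If `x` and `y` differed, `x` would survive the removal of `y`, which leaves a set of size 0.
∣p∣≡1⇒x≡y : ∀ {n} {p : Subset n} {x y} → ∣ p ∣ ≡ 1 → x ∈ p → y ∈ p → x ≡ y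
∣p∣≡1⇒x≡y {p = p} {x} {y} ∣p∣≡1 x∈p y∈p = decidable-stable (x Fin.≟ y) λ x≢y →
  n≮0 (<-≤-trans (x∈p⇒∣p-x∣<∣p∣ (x∈p∧x≢y⇒x∈p-y x∈p x≢y))
                 (≤-reflexive (n<1⇒n≡0 (<-≤-trans (x∈p⇒∣p-x∣<∣p∣ y∈p) (≤-reflexive ∣p∣≡1)))))

module _ {n} (G : SimpleGraph n) where

  Adj⇒∈neighbours : ∀ {x y} → Adj G x y → y ∈ neighbours G x
  Adj⇒∈neighbours {x} {y} xy = lookup⇒[]= y (neighbours G x)
    (trans (lookup∘tabulate _ y) (dec-true (adj? G x y) xy))

  -- Whatever `d` in `D` dominates the leaf `ℓ` is a neighbour of `ℓ`, as is `w`; since `ℓ` has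
  -- degree one, `d` is `w`.
  support∈D : ∀ {D w} → TotalDominating G D → Support G w → w ∈ D
  support∈D {D} td (ℓ , leaf , wℓ) with td ℓ
  ... | d , d∈D , ℓd = subst (_∈ D)
    (∣p∣≡1⇒x≡y leaf (Adj⇒∈neighbours ℓd) (Adj⇒∈neighbours (symm G wℓ))) d∈D

  -- Both counts filter the same list `subsets n`, so equivalent predicates select the same sublist.
  dₜ-cong : ∀ (H : SimpleGraph n) →
    (∀ {D} → TotalDominating G D → TotalDominating H D) →
    (∀ {D} → TotalDominating H D → TotalDominating G D) →
    ∀ i → dₜ G i ≡ dₜ H i
  dₜ-cong H G⇒H H⇒G i = cong length
    (filter-≐ (λ D → totalDominating? G D ×-dec (∣ D ∣ ≟ i))
              (λ D → totalDominating? H D ×-dec (∣ D ∣ ≟ i))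
              (map₁ G⇒H , map₁ H⇒G) (subsets n))

  module _ {u v} (e : Adj G u v) where

    TotalDominating-∖⁻ : ∀ {D} → TotalDominating (G ∖ e) D → TotalDominating G D
    TotalDominating-∖⁻ td x with td x
    ... | d , d∈D , xd , _ = d , d∈D , xd

    -- Only u and v can lose a dominator, and w and z, which lie in every total
    -- dominating set, still dominate them.
    TotalDominating-∖⁺ : ∀ {D w z} → w ≢ v → Adj G u w → Support G w →
      z ≢ u → Adj G v z → Support G z →
      TotalDominating G D → TotalDominating (G ∖ e) D
    TotalDominating-∖⁺ {w = w} {z} w≢v uw sw z≢u vz sz td x with td x
    ... | d , d∈D , xd with samePair? x d u v
    ... | no ne = d , d∈D , xd , ne
    -- Here `u` was dominated through `e`, and `w` takes over. The edge from `u` to `w` is not `e`: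
    -- otherwise `w` would be `v`, or `u` itself, making a loop.
    ... | yes (inj₁ (refl , _)) = w , support∈D td sw , uw , λ where
      (inj₁ (_ , w≡v))  → w≢v w≡v
      (inj₂ (_ , refl)) → irrefl G uw
    ... | yes (inj₂ (refl , _)) = z , support∈D td sz , vz , λ where
      (inj₁ (_ , refl)) → irrefl G vz
      (inj₂ (_ , z≡u))  → z≢u z≡u

theorem2p6 : ∀ (n : ℕ) (G : SimpleGraph n) (u v : Fin n) (e : Adj G u v) →
    (∃ λ w → w ≢ v × Adj G u w × Support G w) →
    (∃ λ z → z ≢ u × Adj G v z × Support G z) →
    Irrelevant G e
theorem2p6 n G u v e (w , w≢v , uw , sw) (z , z≢u , vz , sz) =
  tabulate-cong (dₜ-cong G (G ∖ e)
    (TotalDominating-∖⁺ G e w≢v uw sw z≢u vz sz) (TotalDominating-∖⁻ G e) ∘ toℕ)
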